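{- Let $k$ be any positive integer, and let $L$ be a $2k\times 2k$ cyclic Latin square on symbols $1,2,\dots,2k$, with rows and columns indexed by $1,2,\dots,2k$. Construct an array $A$ from $L$ as follows: in each row $i$ of $L$, for the positions $(i-1)k-(i-2),\ \ldots,\ ik-(i-1)$, taken modulo $2k$, if the symbol in a position is $s$, replace it with a new symbol $s'$. Then $A$ is a $(4k, k, -, -, k : 2k\times 2k)$ AO-array.
   Context: A cyclic Latin square is a Latin square that is a group table of the cyclic group. The symbols $1',\dots,(2k)'$ are distinct from each other and from $1,\dots,2k$. A $(v, e, -, -, \lambda_{rc} : r \times c)$ AO-array (adjusted orthogonal array) is an $r\times c$ array on $v$ symbols such that no symbol occurs more than once in any row or any column, every symbol occurs exactly $e$ times in the array, and every row and every column have exactly $\lambda_{rc}$ common symbols.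
   Formalization: The cyclic Latin square is taken to be the group table with rows and columns both headed in the natural order 1, g, g², … of powers of one generator (symbols named arbitrarily); for arbitrary orders of the headings the claim fails already for k = 2. -}

module Defs where

open import Algebra.Bundles using (Group)
open import Algebra.Definitions.RawMonoid using (_×_)
open import Data.Fin using (Fin; toℕ; fromℕ<)
open import Data.Fin.Properties using (any?; toℕ-fromℕ<)
open import Data.Integer as ℤ using (ℤ; +_; ∣_∣)
open import Data.Integer.Divisibility.Signed using (_∣_; _∣?_)
import Data.Integer.Properties as ℤₚ
open import Data.Integer.Tactic.RingSolver using (solve-∀)
open import Data.List using (List; length)
open import Data.List.Membership.Propositional using (_∈_)
open import Data.List.Relation.Unary.Unique.Propositional using (Unique)
open import Data.Nat as ℕ using (ℕ; suc)
open import Data.Product using (∃; ∃-syntax; _,_; uncurry) renaming (_×_ to _∧_)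
open import Data.Sum using (_⊎_; inj₁; inj₂)
open import Data.Unit using (⊤)
open import Function using (_⇔_; mk⇔)
open import Function.Bundles using (Bijection)
open import Function.Definitions using (Injective; Bijective)
open import Level using (0ℓ)
open import Relation.Binary.PropositionalEquality
  using (_≡_; sym; subst; subst₂)
  renaming (setoid to ≡-setoid)
open import Relation.Nullary using (Dec; yes; no)
open import Relation.Nullary.Decidable using (map; _×-dec_)
open import Relation.Unary using (Decidable)

Array : ℕ → ℕ → Set → Set
Array r c S = Fin r → Fin c → S

-- Exactly n elements of S satisfy P.
HasSize : {S : Set} → (S → Set) → ℕ → Set
HasSize {S} P n =
  ∃[ xs ] Unique xs ∧ length {A = S} xs ≡ n ∧ (∀ s → s ∈ xs ⇔ P s)

-- A (v, e, -, -, λrc : r × c) AO-array whose symbol set is S.  The dashes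
-- mean that there is no condition on pairs of rows or on pairs of columns.
record IsAOArray (v e λrc r c : ℕ) {S : Set} (A : Array r c S) : Set where
  field
    symbols     : HasSize {S} (λ _ → ⊤) v
    rows        : ∀ i → Injective _≡_ _≡_ (A i)
    columns     : ∀ j → Injective _≡_ _≡_ (λ i → A i j)
    occurrences : ∀ s → HasSize (uncurry λ i j → A i j ≡ s) e
    common      : ∀ i j →
      HasSize (λ s → (∃[ y ] A i y ≡ s) ∧ (∃[ x ] A x j ≡ s)) λrc

-- Throughout, the element x of Fin n stands for the number 1 + toℕ x of
-- {1, …, n}, be it a row, a column or a symbol.

record IsLatinSquare {n : ℕ} (L : Array n n (Fin n)) : Set where
  field
    rows    : ∀ i → Bijective _≡_ _≡_ (L i)
    columns : ∀ j → Bijective _≡_ _≡_ (λ i → L i j)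

-- L is the multiplication table of a cyclic group G of order n, with rows and
-- columns both headed by ε, g, g², …, gⁿ⁻¹ for a generator g.  Any naming of
-- the elements of G by the n symbols is allowed.  (m × g is the library's
-- notation for the m-th power of g.)
record IsCyclicGroupTable {n : ℕ} (L : Array n n (Fin n)) : Set₁ where
  field
    G : Group 0ℓ 0ℓ
  open Group G
  field
    g : Carrier
  heading : Fin n → Carrier
  heading i = _×_ rawMonoid (toℕ i) g
  field
    heading-lists-G : ∀ x → ∃[ i ] heading i ≈ x
    name            : Bijection setoid (≡-setoid (Fin n))
    table           : ∀ i j → L i j ≡ Bijection.to name (heading i ∙ heading j)

record IsCyclicLatinSquare {n : ℕ} (L : Array n n (Fin n)) : Set₁ where
  field
    isLatinSquare      : IsLatinSquare L
    isCyclicGroupTable : IsCyclicGroupTable L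

label : {n : ℕ} → Fin n → ℤ
label x = + suc (toℕ x)

-- The positions to be primed in the row labelled i run from firstPos k i to
-- lastPos k i, before reduction modulo 2k.
firstPos lastPos : ℕ → ℤ → ℤ
firstPos k i = (i ℤ.- + 1) ℤ.* + k ℤ.- (i ℤ.- + 2)
lastPos  k i = i ℤ.* + k ℤ.- (i ℤ.- + 1)

Replaced : (k : ℕ) → Fin (2 ℕ.* k) → Fin (2 ℕ.* k) → Set
Replaced k i j =
  ∃[ p ] (firstPos k (label i) ℤ.≤ p ∧ p ℤ.≤ lastPos k (label i))
       ∧ + (2 ℕ.* k) ∣ p ℤ.- label j

between? : {P : ℤ → Set} → Decidable P → ∀ a b →
           Dec (∃[ p ] (a ℤ.≤ p ∧ p ℤ.≤ b) ∧ P p)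
between? {P} P? a b =
  map (mk⇔ to from)
      (any? λ t → (a ℤ.+ + toℕ t ℤ.≤? b) ×-dec P? (a ℤ.+ + toℕ t))
  where
  Offset : Fin (suc ∣ b ℤ.- a ∣) → Set
  Offset t = a ℤ.+ + toℕ t ℤ.≤ b ∧ P (a ℤ.+ + toℕ t)

  to : ∃ Offset → ∃[ p ] (a ℤ.≤ p ∧ p ℤ.≤ b) ∧ P p
  to (t , ≤b , Pp) = a ℤ.+ + toℕ t , (ℤₚ.i≤i+j a (+ toℕ t) , ≤b) , Pp

  cancel : ∀ x y → x ℤ.+ (y ℤ.- x) ≡ y
  cancel = solve-∀

  from : (∃[ p ] (a ℤ.≤ p ∧ p ℤ.≤ b) ∧ P p) → ∃ Offset
  from (p , (a≤p , p≤b) , Pp) =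
    fromℕ< d<
    , subst (ℤ._≤ b) (sym p≡) p≤b
    , subst P (sym p≡) Pp
    where
    abs-p : + ∣ p ℤ.- a ∣ ≡ p ℤ.- a
    abs-p = ℤₚ.0≤i⇒+∣i∣≡i (ℤₚ.i≤j⇒0≤j-i a≤p)
    abs-b : + ∣ b ℤ.- a ∣ ≡ b ℤ.- a
    abs-b = ℤₚ.0≤i⇒+∣i∣≡i (ℤₚ.i≤j⇒0≤j-i (ℤₚ.≤-trans a≤p p≤b))
    d< : ∣ p ℤ.- a ∣ ℕ.< suc ∣ b ℤ.- a ∣
    d< = ℕ.s≤s (ℤₚ.drop‿+≤+ (subst₂ ℤ._≤_ (sym abs-p) (sym abs-b)
           (ℤₚ.+-monoˡ-≤ (ℤ.- a) p≤b)))
    p≡ : a ℤ.+ + toℕ (fromℕ< d<) ≡ p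
    p≡ rewrite toℕ-fromℕ< d< | abs-p = cancel a p

replaced? : ∀ k i j → Dec (Replaced k i j)
replaced? k i j =
  between? (λ p → + (2 ℕ.* k) ∣? p ℤ.- label j)
           (firstPos k (label i)) (lastPos k (label i))

-- The 4k symbols: inj₁ s is the original symbol s and inj₂ s is s′.
Symbol : ℕ → Set
Symbol k = Fin (2 ℕ.* k) ⊎ Fin (2 ℕ.* k)

prime : (k : ℕ) → Array (2 ℕ.* k) (2 ℕ.* k) (Fin (2 ℕ.* k)) →
        Array (2 ℕ.* k) (2 ℕ.* k) (Symbol k)
prime k L i j with replaced? k i j
... | yes _ = inj₂ (L i j)
... | no  _ = inj₁ (L i j)

{-# OPTIONS --safe #-}

-- Number rows and columns from 0 and let m be the residue of i + j modulo 2k,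
-- so that the entry L i j depends only on m, and determines it.  In row i the
-- primed cells are those with m in the block [ik, ik + k) modulo 2k, that is,
-- those where m lies in the half of {0, …, 2k - 1} given by the parity of i.
-- Hence the entry A i j determines, and is determined by, the pair
-- (L i j , parity of i), and every such pair occurs as a symbol.
-- All counts then become counts of the k rows of a given parity.
module Submission where

open import Defs
open import Algebra.Bundles using (Group)
import Algebra.Properties.Group as GroupProperties
import Algebra.Properties.Monoid.Mult as Mult
open import Data.Nat using (ℕ; zero; suc; _*_; _%_; _/_; NonZero)
import Data.Nat as ℕ
open import Data.Nat.DivMod using (m≡m%n+[m/n]*n; m%n<n)
import Data.Nat.Divisibility as ℕ∣
import Data.Nat.Properties as ℕₚ
import Data.Nat.Tactic.RingSolver as ℕ-Solver
open import Data.Fin using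
  (Fin; zero; suc; toℕ; fromℕ; fromℕ<; inject₁; cast; combine; quotient;
   remainder; splitAt; join; opposite; _≟_)
open import Data.Fin.Properties using
  (toℕ<n; toℕ-injective; toℕ-fromℕ; toℕ-fromℕ<; toℕ-inject₁; fromℕ≢inject₁;
   toℕ-cast; cast-involutive; toℕ-combine; remQuot-combine; combine-remQuot;
   combine-injectiveˡ; splitAt-join; join-splitAt)
open import Data.Integer as ℤ using (+_; ∣_∣)
open import Data.Integer.Divisibility.Signed using (_∣_; divides; ∣⇒∣ᵤ)
import Data.Integer.Properties as ℤₚ
open import Data.Integer.Tactic.RingSolver using (solve-∀)
open import Data.List using (tabulate)
open import Data.List.Properties using (length-tabulate)
open import Data.List.Membership.Propositional using (_∈_)
open import Data.List.Membership.Propositional.Properties using (∈-tabulate⁺; ∈-tabulate⁻)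
open import Data.List.Relation.Unary.Unique.Propositional.Properties using (tabulate⁺)
open import Data.Product using (∃-syntax; ∃₂; _,_; _×_; proj₁; proj₂)
open import Data.Sum using (inj₁; inj₂)
open import Data.Unit using (⊤; tt)
open import Function using (_⇔_; mk⇔; Equivalence)
open import Function.Bundles using (Bijection)
open import Function.Definitions using (Injective)
open import Relation.Binary.PropositionalEquality
  using (_≡_; refl; sym; trans; cong; cong₂; subst; module ≡-Reasoning)
import Relation.Binary.Reasoning.Setoid as SetoidReasoning
open import Relation.Nullary using (¬_; yes; no; contradiction)

-- Counting by enumeration, and residues as elements of `Fin n`.

-- The tool behind every count below: injectivity makes the list of values of `f` duplicate-free,
-- and the other two hypotheses make it sound and complete for `P`.
HasSize-image : ∀ {S : Set} {P : S → Set} {n} (f : Fin n → S) →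
  Injective _≡_ _≡_ f → (∀ t → P (f t)) → (∀ s → P s → ∃[ t ] f t ≡ s) →
  HasSize P n
HasSize-image {P = P} f f-inj P-f f-onto =
  tabulate f , tabulate⁺ f-inj , length-tabulate f ,
  λ s → mk⇔ (λ s∈ → let t , s≡ = ∈-tabulate⁻ s∈ in subst P (sym s≡) (P-f t))
            (λ Ps → let t , ≡s = f-onto s Ps in subst (_∈ tabulate f) ≡s (∈-tabulate⁺ t))

splitAt-injective : ∀ m {n} → Injective _≡_ _≡_ (splitAt m {n})
splitAt-injective m {n} {x} {y} eq =
  trans (sym (join-splitAt m n x)) (trans (cong (join m n) eq) (join-splitAt m n y))

HasSize-Symbol : ∀ k → HasSize {Symbol k} (λ _ → ⊤) (4 * k)
HasSize-Symbol k = subst (HasSize _) (double k)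
  (HasSize-image (splitAt (2 * k)) (splitAt-injective (2 * k)) (λ _ → tt)
    (λ s _ → join (2 * k) (2 * k) s , splitAt-join (2 * k) (2 * k) s))
  where
  double : ∀ k → 2 * k ℕ.+ 2 * k ≡ 4 * k
  double = ℕ-Solver.solve-∀

-- Two numbers below `n` differ by less than `n` in absolute value, and the only multiple of `n`
-- that small is 0.
congruent⇒≡ : ∀ {n} (x y : Fin n) → + n ∣ + toℕ x ℤ.- + toℕ y → x ≡ y
congruent⇒≡ {n} x y n∣x-y = toℕ-injective (ℤₚ.+-injective (ℤₚ.i-j≡0⇒i≡j _ _
  (ℤₚ.∣i∣≡0⇒i≡0 (small-multiple (∣⇒∣ᵤ n∣x-y) ∣x-y∣<n))))
  where
  small-multiple : ∀ {d} → n ℕ∣.∣ d → d ℕ.< n → d ≡ 0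
  small-multiple {zero}  _   _   = refl
  small-multiple {suc d} n∣d d<n = contradiction n∣d (ℕ∣.>⇒∤ d<n)
  ∣x-y∣<n : ∣ + toℕ x ℤ.- + toℕ y ∣ ℕ.< n
  ∣x-y∣<n = subst (ℕ._< n) (cong ∣_∣ (sym (ℤₚ.m-n≡m⊖n (toℕ x) (toℕ y))))
    (ℕₚ.≤-<-trans (ℤₚ.∣m⊝n∣≤m⊔n (toℕ x) (toℕ y)) (ℕₚ.⊔-lub (toℕ<n x) (toℕ<n y)))

+toℕ-combine : ∀ {m n} (x : Fin m) (y : Fin n) →
  + toℕ (combine x y) ≡ + n ℤ.* + toℕ x ℤ.+ + toℕ y
+toℕ-combine {n = n} x y =
  trans (cong +_ (toℕ-combine x y)) (cong (ℤ._+ + toℕ y) (ℤₚ.pos-* n (toℕ x)))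

-- Two ways to split an index below `2 * k`: by parity and by half.

module _ (k : ℕ) where

  -- This is row `2t + p`, counting from 0. Its base-2 digits live in `Fin (k * 2)`, hence the cast;
  -- `half` is the leading digit in base `k` and needs none.
  ofParity : Fin 2 → Fin k → Fin (2 * k)
  ofParity p t = cast (ℕₚ.*-comm k 2) (combine t p)

  parity : Fin (2 * k) → Fin 2
  parity i = remainder {k} 2 (cast (ℕₚ.*-comm 2 k) i)

  half : Fin (2 * k) → Fin 2
  half = quotient k

  uncast-ofParity : ∀ p t → cast (ℕₚ.*-comm 2 k) (ofParity p t) ≡ combine t p
  uncast-ofParity p t = cast-involutive (ℕₚ.*-comm 2 k) (ℕₚ.*-comm k 2) (combine t p)

  parity-ofParity : ∀ p t → parity (ofParity p t) ≡ p
  parity-ofParity p t = trans (cong (remainder {k} 2) (uncast-ofParity p t))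
                              (cong proj₂ (remQuot-combine t p))

  parity⇒ofParity : ∀ i → ∃[ t ] ofParity (parity i) t ≡ i
  parity⇒ofParity i = quotient {k} 2 i′ , trans
    (cong (cast (ℕₚ.*-comm k 2)) (combine-remQuot {k} 2 i′))
    (cast-involutive (ℕₚ.*-comm k 2) (ℕₚ.*-comm 2 k) i)
    where i′ = cast (ℕₚ.*-comm 2 k) i

  ofParity-injective : ∀ p → Injective _≡_ _≡_ (ofParity p)
  ofParity-injective p {t} {u} eq = combine-injectiveˡ t p u p
    (trans (sym (uncast-ofParity p t))
           (trans (cong (cast (ℕₚ.*-comm 2 k)) eq) (uncast-ofParity p u)))

  +toℕ-halves : ∀ m → ∃[ r ] + toℕ m ≡ + k ℤ.* + toℕ (half m) ℤ.+ + toℕ {k} r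
  +toℕ-halves m = remainder {2} k m ,
    trans (cong (λ z → + toℕ z) (sym (combine-remQuot {2} k m)))
          (+toℕ-combine (half m) (remainder {2} k m))

  +toℕ-parity : ∀ i → ∃[ t ] + toℕ i ≡ + 2 ℤ.* t ℤ.+ + toℕ (parity i)
  +toℕ-parity i with t , ofParity≡i ← parity⇒ofParity i = + toℕ t ,
    trans (cong (λ z → + toℕ z) (sym ofParity≡i))
    (trans (cong +_ (toℕ-cast (ℕₚ.*-comm k 2) (combine t (parity i))))
           (+toℕ-combine t (parity i)))

-- The primed block of a row.

-- With indices from 0, the column label `1 + J` exceeds `first` by `I + J - I * K`, which is
-- congruent to `M - I * K`. Since `I = 2T + P`, the multiple `I * K` is congruent to `P * K`, so
-- the block of length `k` becomes exactly the half numbered `P`.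
Replaced⇔half≡parity : ∀ k (i j m : Fin (2 * k)) →
  + (2 * k) ∣ (+ toℕ i ℤ.+ + toℕ j) ℤ.- + toℕ m →
  Replaced k i j ⇔ half k m ≡ parity k i
Replaced⇔half≡parity k i j m (divides w i+j-m≡)
  with T , i≡ ← +toℕ-parity k i | r , m≡ ← +toℕ-halves k m = mk⇔ to from
  where
  I = + toℕ i
  J = + toℕ j
  M = + toℕ m
  K = + k
  R = + toℕ r
  P = + toℕ (parity k i)
  first = firstPos k (label i)
  last  = lastPos k (label i)

  2k≡ : + (2 * k) ≡ + 2 ℤ.* K
  2k≡ = ℤₚ.pos-* 2 k

  block-length : last ≡ first ℤ.+ K ℤ.- + 1
  block-length = lemma I K
    where
    lemma : ∀ I K → (+ 1 ℤ.+ I) ℤ.* K ℤ.- ((+ 1 ℤ.+ I) ℤ.- + 1) ≡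
      ((+ 1 ℤ.+ I) ℤ.- + 1) ℤ.* K ℤ.- ((+ 1 ℤ.+ I) ℤ.- + 2) ℤ.+ K ℤ.- + 1
    lemma = solve-∀

  to : Replaced k i j → half k m ≡ parity k i
  to (p , (first≤p , p≤last) , divides q p-j≡) =
    trans (cong (half k) m≡y) (cong proj₁ (remQuot-combine (parity k i) (fromℕ< d<k)))
    where
    d = ∣ p ℤ.- first ∣

    +d≡ : + d ≡ p ℤ.- first
    +d≡ = ℤₚ.0≤i⇒+∣i∣≡i (ℤₚ.i≤j⇒0≤j-i first≤p)

    p-first<K : p ℤ.- first ℤ.< K
    p-first<K = ℤₚ.≤-<-trans (ℤₚ.+-monoˡ-≤ (ℤ.- first) p≤last)
      (subst (ℤ._< K) (sym (trans (cong (ℤ._- first) block-length) (lemma first K)))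
        (ℤₚ.i≤pred[j]⇒i<j ℤₚ.≤-refl))
      where
      -- The right-hand side is ℤ.pred K, unfolded because the solver does not see through pred.
      lemma : ∀ f K → f ℤ.+ K ℤ.- + 1 ℤ.- f ≡ (ℤ.- + 1) ℤ.+ K
      lemma = solve-∀

    d<k : d ℕ.< k
    d<k = ℤₚ.drop‿+<+ (subst (ℤ._< K) (sym +d≡) p-first<K)

    -- The member of the half `parity k i` at distance `d` from its start. It will turn out
    -- congruent to `m`, hence equal to it, so the half of `m` can be read off.
    y : Fin (2 * k)
    y = combine (parity k i) (fromℕ< d<k)

    y≡ : + toℕ y ≡ K ℤ.* P ℤ.+ (p ℤ.- first)
    y≡ = trans (+toℕ-combine (parity k i) (fromℕ< d<k))
      (cong (λ z → K ℤ.* P ℤ.+ z) (trans (cong +_ (toℕ-fromℕ< d<k)) +d≡))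

    m≡y : m ≡ y
    -- The quotient collects three multiples of `2 * k`: `T` from the parity of the row, `w` from
    -- `i + j` against `m`, and `q` from `p` against the column label.
    m≡y = congruent⇒≡ m y (divides (T ℤ.- w ℤ.- q) (begin
      M ℤ.- + toℕ y
        ≡⟨ cong (λ z → M ℤ.- z) y≡ ⟩
      M ℤ.- (K ℤ.* P ℤ.+ (p ℤ.- first))
        ≡⟨ regroup I J M K P p ⟩
      (I ℤ.- P) ℤ.* K ℤ.- (I ℤ.+ J ℤ.- M) ℤ.- (p ℤ.- (+ 1 ℤ.+ J))
        ≡⟨ cong₂ ℤ._-_ (cong₂ (λ a b → (a ℤ.- P) ℤ.* K ℤ.- b) i≡ i+j-m≡) p-j≡ ⟩
      (+ 2 ℤ.* T ℤ.+ P ℤ.- P) ℤ.* K ℤ.- w ℤ.* + (2 * k) ℤ.- q ℤ.* + (2 * k)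
        ≡⟨ cong (λ n → (+ 2 ℤ.* T ℤ.+ P ℤ.- P) ℤ.* K ℤ.- w ℤ.* n ℤ.- q ℤ.* n) 2k≡ ⟩
      (+ 2 ℤ.* T ℤ.+ P ℤ.- P) ℤ.* K ℤ.- w ℤ.* (+ 2 ℤ.* K) ℤ.- q ℤ.* (+ 2 ℤ.* K)
        ≡⟨ collect T P K w q ⟩
      (T ℤ.- w ℤ.- q) ℤ.* (+ 2 ℤ.* K)
        ≡⟨ cong ((T ℤ.- w ℤ.- q) ℤ.*_) 2k≡ ⟨
      (T ℤ.- w ℤ.- q) ℤ.* + (2 * k) ∎))
      where
      open ≡-Reasoning
      regroup : ∀ I J M K P p →
        M ℤ.- (K ℤ.* P ℤ.+ (p ℤ.-
          (((+ 1 ℤ.+ I) ℤ.- + 1) ℤ.* K ℤ.- ((+ 1 ℤ.+ I) ℤ.- + 2)))) ≡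
        (I ℤ.- P) ℤ.* K ℤ.- (I ℤ.+ J ℤ.- M) ℤ.- (p ℤ.- (+ 1 ℤ.+ J))
      regroup = solve-∀
      collect : ∀ T P K w q →
        (+ 2 ℤ.* T ℤ.+ P ℤ.- P) ℤ.* K ℤ.- w ℤ.* (+ 2 ℤ.* K) ℤ.- q ℤ.* (+ 2 ℤ.* K) ≡
        (T ℤ.- w ℤ.- q) ℤ.* (+ 2 ℤ.* K)
      collect = solve-∀

  from : half k m ≡ parity k i → Replaced k i j
  from half≡parity =
    -- The witness lies as far into the block as `m` lies into its half.
    first ℤ.+ R , (ℤₚ.i≤i+j first R , first+R≤last) , divides (T ℤ.- w) (begin
      first ℤ.+ R ℤ.- (+ 1 ℤ.+ J)
        ≡⟨ regroup I J M K R ⟩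
      I ℤ.* K ℤ.+ R ℤ.- M ℤ.- (I ℤ.+ J ℤ.- M)
        ≡⟨ cong₂ ℤ._-_ (cong₂ (λ a b → a ℤ.* K ℤ.+ R ℤ.- b) i≡
             (trans m≡ (cong (λ h → K ℤ.* + toℕ h ℤ.+ R) half≡parity))) i+j-m≡ ⟩
      (+ 2 ℤ.* T ℤ.+ P) ℤ.* K ℤ.+ R ℤ.- (K ℤ.* P ℤ.+ R) ℤ.- w ℤ.* + (2 * k)
        ≡⟨ cong (λ n → (+ 2 ℤ.* T ℤ.+ P) ℤ.* K ℤ.+ R ℤ.- (K ℤ.* P ℤ.+ R) ℤ.- w ℤ.* n) 2k≡ ⟩
      (+ 2 ℤ.* T ℤ.+ P) ℤ.* K ℤ.+ R ℤ.- (K ℤ.* P ℤ.+ R) ℤ.- w ℤ.* (+ 2 ℤ.* K)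
        ≡⟨ collect T P K R w ⟩
      (T ℤ.- w) ℤ.* (+ 2 ℤ.* K)
        ≡⟨ cong ((T ℤ.- w) ℤ.*_) 2k≡ ⟨
      (T ℤ.- w) ℤ.* + (2 * k) ∎)
    where
    open ≡-Reasoning
    regroup : ∀ I J M K R →
      ((+ 1 ℤ.+ I) ℤ.- + 1) ℤ.* K ℤ.- ((+ 1 ℤ.+ I) ℤ.- + 2) ℤ.+ R ℤ.- (+ 1 ℤ.+ J) ≡
      I ℤ.* K ℤ.+ R ℤ.- M ℤ.- (I ℤ.+ J ℤ.- M)
    regroup = solve-∀
    collect : ∀ T P K R w →
      (+ 2 ℤ.* T ℤ.+ P) ℤ.* K ℤ.+ R ℤ.- (K ℤ.* P ℤ.+ R) ℤ.- w ℤ.* (+ 2 ℤ.* K) ≡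
      (T ℤ.- w) ℤ.* (+ 2 ℤ.* K)
    collect = solve-∀
    first+R≤last : first ℤ.+ R ℤ.≤ last
    first+R≤last = subst (first ℤ.+ R ℤ.≤_) (sym (trans block-length (lemma first K)))
      (ℤₚ.+-monoʳ-≤ first (ℤₚ.i<j⇒i≤pred[j] (ℤ.+<+ (toℕ<n r))))
      where
      lemma : ∀ f K → f ℤ.+ K ℤ.- + 1 ≡ f ℤ.+ ((ℤ.- + 1) ℤ.+ K)
      lemma = solve-∀

-- Exponents of the generator in a cyclic table.

module _ {n : ℕ} {L : Array (suc n) (suc n) (Fin (suc n))}
         (latin : IsLatinSquare L) (isTable : IsCyclicGroupTable L) where

  open IsCyclicGroupTable isTable
  open Group G using (_≈_; _∙_; ε; monoid; ∙-cong; identityˡ; identityʳ; setoid)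
    renaming (refl to ≈-refl; sym to ≈-sym; trans to ≈-trans)
  open GroupProperties G using (∙-cancelˡ)
  open Mult monoid using (×-homo-+; ×-congˡ) renaming (_×_ to _×ᵍ_)
  open SetoidReasoning setoid
  private module Name = Bijection name

  L≡name : ∀ i j → L i j ≡ Name.to ((toℕ i ℕ.+ toℕ j) ×ᵍ g)
  L≡name i j = trans (table i j) (Name.cong (≈-sym (×-homo-+ g (toℕ i) (toℕ j))))

  -- Row `zero` is headed by the identity, so two equal headings would repeat a symbol in it.
  heading-injective : ∀ {x y} → heading x ≈ heading y → x ≡ y
  heading-injective {x} {y} hx≈hy = proj₁ (IsLatinSquare.rows latin zero)
    (trans (L≡name zero x) (trans (Name.cong hx≈hy) (sym (L≡name zero y))))

  -- gⁿ⁺¹ is some listed power; were it gᵐ⁺¹, cancelling g would make gⁿ equal the earlier power gᵐ.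
  order×g≈ε : suc n ×ᵍ g ≈ ε
  order×g≈ε with heading-lists-G (suc n ×ᵍ g)
  ... | zero  , ε≈  = ≈-sym ε≈
  ... | suc m , gm≈ = contradiction (sym (heading-injective (begin
    toℕ (inject₁ m) ×ᵍ g   ≈⟨ ×-congˡ (toℕ-inject₁ m) ⟩
    toℕ m ×ᵍ g             ≈⟨ ∙-cancelˡ g (toℕ m ×ᵍ g) (n ×ᵍ g) gm≈ ⟩
    n ×ᵍ g                 ≈⟨ ×-congˡ (toℕ-fromℕ n) ⟨
    toℕ (fromℕ n) ×ᵍ g     ∎))) (fromℕ≢inject₁ {i = m})

  multiple×g≈ε : ∀ q → (q * suc n) ×ᵍ g ≈ ε
  multiple×g≈ε zero    = ≈-refl
  multiple×g≈ε (suc q) = begin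
    (suc n ℕ.+ q * suc n) ×ᵍ g         ≈⟨ ×-homo-+ g (suc n) (q * suc n) ⟩
    suc n ×ᵍ g ∙ (q * suc n) ×ᵍ g      ≈⟨ ∙-cong order×g≈ε (multiple×g≈ε q) ⟩
    ε ∙ ε                              ≈⟨ identityˡ ε ⟩
    ε                                  ∎

  residue×g : ∀ x → (x % suc n) ×ᵍ g ≈ x ×ᵍ g
  residue×g x = begin
    r ×ᵍ g                             ≈⟨ identityʳ (r ×ᵍ g) ⟨
    r ×ᵍ g ∙ ε                         ≈⟨ ∙-cong ≈-refl (multiple×g≈ε q) ⟨
    r ×ᵍ g ∙ (q * suc n) ×ᵍ g          ≈⟨ ×-homo-+ g r (q * suc n) ⟨
    (r ℕ.+ q * suc n) ×ᵍ g             ≈⟨ ×-congˡ (m≡m%n+[m/n]*n x (suc n)) ⟨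
    x ×ᵍ g                             ∎
    where
    r = x % suc n
    q = x / suc n

  -- Row `zero` serves as a discrete logarithm: its column `m` holds the name of the `m`-th power of
  -- `g`. Names are injective and the listed powers distinct, so the symbol fixes the exponent
  -- modulo `suc n`.
  row₀-residue : ∀ i j m → L zero m ≡ L i j → toℕ m ≡ (toℕ i ℕ.+ toℕ j) % suc n
  row₀-residue i j m eq = trans (cong toℕ m≡r) (toℕ-fromℕ< r<)
    where
    r< = m%n<n (toℕ i ℕ.+ toℕ j) (suc n)
    m≡r : m ≡ fromℕ< r<
    m≡r = heading-injective (begin
      toℕ m ×ᵍ g
        ≈⟨ Name.injective (trans (sym (L≡name zero m)) (trans eq (L≡name i j))) ⟩
      (toℕ i ℕ.+ toℕ j) ×ᵍ g
        ≈⟨ residue×g (toℕ i ℕ.+ toℕ j) ⟨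
      ((toℕ i ℕ.+ toℕ j) % suc n) ×ᵍ g
        ≈⟨ ×-congˡ (toℕ-fromℕ< r<) ⟨
      toℕ (fromℕ< r<) ×ᵍ g ∎)

  row₀-congruent : ∀ i j m → L zero m ≡ L i j →
    + suc n ∣ (+ toℕ i ℤ.+ + toℕ j) ℤ.- + toℕ m
  row₀-congruent i j m eq = divides (+ q) i+j-m≡
    where
    x = toℕ i ℕ.+ toℕ j
    q = x / suc n
    cancel : ∀ r y → r ℤ.+ y ℤ.- r ≡ y
    cancel = solve-∀
    i+j-m≡ : + x ℤ.- + toℕ m ≡ + q ℤ.* + suc n
    i+j-m≡ = trans
      (cong₂ (λ a b → + a ℤ.- + b) (m≡m%n+[m/n]*n x (suc n)) (row₀-residue i j m eq))
      (trans (cancel (+ (x % suc n)) (+ (q * suc n))) (ℤₚ.pos-* q (suc n)))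

-- Entries as pairs of a symbol and a row parity.

differ-from-common⇒≡ : (h p q : Fin 2) → ¬ h ≡ p → ¬ h ≡ q → p ≡ q
differ-from-common⇒≡ zero       zero       _          h≢p _   = contradiction refl h≢p
differ-from-common⇒≡ zero       (suc zero) zero       _   h≢q = contradiction refl h≢q
differ-from-common⇒≡ zero       (suc zero) (suc zero) _   _   = refl
differ-from-common⇒≡ (suc zero) (suc zero) _          h≢p _   = contradiction refl h≢p
differ-from-common⇒≡ (suc zero) zero       (suc zero) _   h≢q = contradiction refl h≢q
differ-from-common⇒≡ (suc zero) zero       zero       _   _   = refl

≢-opposite : (h : Fin 2) → ¬ h ≡ opposite h
≢-opposite zero       ()
≢-opposite (suc zero) ()

-- c x is the parity of the rows in which x is primed.
module _ {k : ℕ} (c : Fin (2 * k) → Fin 2) where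

  tag : Fin (2 * k) → Fin 2 → Symbol k
  tag x p with c x ≟ p
  ... | yes _ = inj₂ x
  ... | no  _ = inj₁ x

  -- The prime tells whether `p` equals `c x`. If it does not, `p` is still determined, as only two
  -- parities exist.
  tag-injective : ∀ {x p y q} → tag x p ≡ tag y q → x ≡ y × p ≡ q
  tag-injective {x} {p} {y} {q} eq with c x ≟ p | c y ≟ q | eq
  ... | yes refl | yes refl | refl = refl , refl
  ... | no  cx≢p | no  cx≢q | refl = refl , differ-from-common⇒≡ (c x) p q cx≢p cx≢q

  tag-surjective : ∀ s → ∃₂ λ x p → tag x p ≡ s
  tag-surjective (inj₁ x) = x , opposite (c x) , untouched
    where
    untouched : tag x (opposite (c x)) ≡ inj₁ x
    untouched with c x ≟ opposite (c x)
    ... | yes c≡ = contradiction c≡ (≢-opposite (c x))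
    ... | no  _  = refl
  tag-surjective (inj₂ x) = x , c x , primed
    where
    primed : tag x (c x) ≡ inj₂ x
    primed with c x ≟ c x
    ... | yes _  = refl
    ... | no c≢c = contradiction refl c≢c

  prime≡tag : ∀ (L : Array (2 * k) (2 * k) (Fin (2 * k))) i j →
    Replaced k i j ⇔ c (L i j) ≡ parity k i → prime k L i j ≡ tag (L i j) (parity k i)
  prime≡tag L i j replaced⇔ with replaced? k i j | c (L i j) ≟ parity k i
  ... | yes _  | yes _ = refl
  ... | yes r  | no ¬c = contradiction (Equivalence.to replaced⇔ r) ¬c
  ... | no  ¬r | yes c = contradiction (Equivalence.from replaced⇔ c) ¬r
  ... | no  _  | no  _ = refl

  -- Equal entries of `A` carry equal symbols of `L`, which settles rows and columns. They also lie
  -- in rows of equal parity, and `ofParity` enumerates the `k` rows of each parity for both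
  -- remaining counts.
  tagged-isAOArray : ∀ {L : Array (2 * k) (2 * k) (Fin (2 * k))} {A} → IsLatinSquare L →
    (∀ i j → A i j ≡ tag (L i j) (parity k i)) → IsAOArray (4 * k) k k (2 * k) (2 * k) A
  tagged-isAOArray {L} {A} latin A≡ = record
    { symbols     = HasSize-Symbol k
    ; rows        = λ i eq → proj₁ (Latin.rows i) (proj₁ (A-injective eq))
    ; columns     = λ j eq → proj₁ (Latin.columns j) (proj₁ (A-injective eq))
    ; occurrences = occurrences
    ; common      = common
    }
    where
    module Latin = IsLatinSquare latin

    A-injective : ∀ {i j x y} → A i j ≡ A x y → L i j ≡ L x y × parity k i ≡ parity k x
    A-injective {i} {j} {x} {y} eq = tag-injective (trans (sym (A≡ i j)) (trans eq (A≡ x y)))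

    column : ∀ i s → ∃[ j ] L i j ≡ s
    column i s = let j , L≡s = proj₂ (Latin.rows i) s in j , L≡s refl

    occurrences : ∀ s → HasSize (λ (i , j) → A i j ≡ s) k
    -- Writing `s` as `tag x p` confines it to rows of parity `p`; each of them holds it once, in
    -- the column where `L` has `x`.
    occurrences s with x , p , refl ← tag-surjective s =
      HasSize-image cell (λ eq → ofParity-injective k p (cong proj₁ eq)) cell-correct cell-complete
      where
      cell : Fin k → Fin (2 * k) × Fin (2 * k)
      cell t = ofParity k p t , proj₁ (column (ofParity k p t) x)

      cell-correct : ∀ t → A (proj₁ (cell t)) (proj₂ (cell t)) ≡ tag x p
      cell-correct t = trans (A≡ _ _)
        (cong₂ tag (proj₂ (column (ofParity k p t) x)) (parity-ofParity k p t))

      cell-complete : ∀ ij → A (proj₁ ij) (proj₂ ij) ≡ tag x p → ∃[ t ] cell t ≡ ij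
      cell-complete (i , j) eq
        with refl , refl ← tag-injective (trans (sym (A≡ i j)) eq)
        with t , ofParity≡i ← parity⇒ofParity k i =
        t , same-cell ofParity≡i
        where
        -- Generalising the row to a variable lets the equation be matched with `refl`; the columns
        -- then agree because row `i` of `L` holds `L i j` only once.
        same-cell : ∀ {i′} → i′ ≡ i → (i′ , proj₁ (column i′ (L i j))) ≡ (i , j)
        same-cell refl = cong (i ,_) (proj₁ (Latin.rows i) (proj₂ (column i (L i j))))

    common : ∀ i j → HasSize (λ s → (∃[ y ] A i y ≡ s) × (∃[ x ] A x j ≡ s)) k
    -- The common symbols are the entries of column `j` in the rows with the parity of `i`: row `i`
    -- contains every symbol of `L`, and tags it with that same parity.
    common i j = HasSize-image entry entry-injective
      (λ t → in-row t , row t , refl) entry-complete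
      where
      row : Fin k → Fin (2 * k)
      row = ofParity k (parity k i)

      entry : Fin k → Symbol k
      entry t = A (row t) j

      entry-injective : Injective _≡_ _≡_ entry
      entry-injective eq =
        ofParity-injective k (parity k i) (proj₁ (Latin.columns j) (proj₁ (A-injective eq)))

      in-row : ∀ t → ∃[ y ] A i y ≡ entry t
      in-row t = let y , L≡ = column i (L (row t) j) in y ,
        trans (A≡ i y) (trans (cong₂ tag L≡ (sym (parity-ofParity k (parity k i) t)))
                              (sym (A≡ (row t) j)))

      entry-complete : ∀ s → (∃[ y ] A i y ≡ s) × (∃[ x ] A x j ≡ s) → ∃[ t ] entry t ≡ s
      entry-complete _ ((y , Aiy≡) , (x , refl))
        with t , ofParity≡x ← parity⇒ofParity k x =
        -- The shared entry forces `x` to have the parity of `i`, so `x` is one of the enumerated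
        -- rows.
        t , cong (λ z → A z j)
              (trans (cong (λ p → ofParity k p t) (proj₂ (A-injective Aiy≡))) ofParity≡x)

theorem4p7 : (k : ℕ) → .{{_ : NonZero k}} →
    (L : Array (2 * k) (2 * k) (Fin (2 * k))) →
    IsCyclicLatinSquare L →
    IsAOArray (4 * k) k k (2 * k) (2 * k) (prime k L)
-- Matching on `suc _` turns `2 * k` into a successor, so that row `zero` exists.
theorem4p7 k@(suc _) L cyclic = tagged-isAOArray c isLatinSquare λ i j →
  prime≡tag c L i j (Replaced⇔half≡parity k i j (row₀-position (L i j))
    (row₀-congruent isLatinSquare isCyclicGroupTable i j _ (L-row₀-position (L i j))))
  where
  open IsCyclicLatinSquare cyclic

  row₀-position : Fin (2 * k) → Fin (2 * k)
  row₀-position s = proj₁ (proj₂ (IsLatinSquare.rows isLatinSquare zero) s)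

  L-row₀-position : ∀ s → L zero (row₀-position s) ≡ s
  L-row₀-position s = proj₂ (proj₂ (IsLatinSquare.rows isLatinSquare zero) s) refl

  -- The column of `s` in row `zero` is the residue of `i + j` at every cell where `L` has `s`, so
  -- its half is the parity of the rows that prime `s`.
  c : Fin (2 * k) → Fin 2
  c s = half k (row₀-position s)
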